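{- Let $(\mathbf{d},\mathbf{r})$ be an arithmetical structure on the complete graph $K_n$ with vertices $v_1,\dotsc,v_n$, and write $d_i=d_{v_i}$. Then \[\mathcal{K}(K_n;\mathbf{d},\mathbf{r})\oplus (\mathbb{Z}/\ell\mathbb{Z})^2 \cong \bigoplus_{i=1}^n \mathbb{Z}/(d_i+1)\mathbb{Z},\] where $\ell=\operatorname{lcm}(d_1+1,d_2+1,\dotsc, d_n+1)$.
   Context: An arithmetical structure on a finite, connected, loopless graph $G$ with vertex set $V(G)$ is a pair $(\mathbf{d},\mathbf{r})$, where $\mathbf{r}=(r_v)_{v\in V(G)}$ consists of positive integers with no common factor, $\mathbf{d}=(d_v)_{v\in V(G)}$ consists of nonnegative integers, and for every vertex $v$ we have $r_vd_v=\sum r_u$, the sum being over all $u$ adjacent to $v$ (with multiplicity for multigraphs). Its critical group $\mathcal{K}(G;\mathbf{d},\mathbf{r})$ is the torsion part of the cokernel (over $\mathbb{Z}$) of the matrix $L(G,\mathbf{d})=\operatorname{diag}(\mathbf{d})-A(G)$, where $A(G)$ is the adjacency matrix of $G$. $K_n$ denotes the (simple) complete graph on $n$ vertices. -}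

module Defs where

open import Algebra.Bundles using (AbelianGroup)
import Algebra.Construct.DirectProduct as DirectProduct
import Algebra.Definitions.RawMonoid as RawMonoidDefinitions
open import Algebra.Morphism.Structures using (IsGroupIsomorphism)
import Algebra.Properties.AbelianGroup as AbelianGroupProperties
import Algebra.Properties.CommutativeMonoid.Mult as Mult
import Algebra.Properties.Semiring.Sum as Sum
open import Data.Bool.Base using (if_then_else_)
open import Data.Fin.Base using (Fin)
open import Data.Fin.Properties using (_≟_)
open import Data.Integer.Base as ℤ using (ℤ; +_; 0ℤ)
import Data.Integer.Divisibility.Signed as ℤ
import Data.Integer.Properties as ℤ
open import Data.Nat.Base as ℕ using (ℕ; zero; suc; NonZero)
import Data.Nat.Divisibility as ℕ
open import Data.Nat.LCM using (lcm)
import Data.Nat.Properties as ℕ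
open import Data.Product.Base using (∃; _×_; _,_; proj₁)
open import Data.Vec.Functional using (Vector; foldr)
open import Level using (Level; 0ℓ; _⊔_) renaming (suc to lsuc)
open import Relation.Binary.Construct.Closure.ReflexiveTransitive
  using (Star) renaming (ε to []; _◅_ to _∷_)
open import Relation.Binary.PropositionalEquality
  using (_≡_; refl; sym; trans; cong; cong₂; subst)
open import Relation.Nullary using (does; yes; no; contradiction)

private
  variable
    a b ℓ₁ ℓ₂ p : Level
    m n : ℕ

module ℤΣ = Sum ℤ.+-*-semiring
module ℕΣ = Sum ℕ.+-*-semiring

infix  4 _≅_
infixr 6 _⊕_

_≅_ : AbelianGroup a ℓ₁ → AbelianGroup b ℓ₂ → Set (a ⊔ b ⊔ ℓ₁ ⊔ ℓ₂)
G ≅ H = ∃ (IsGroupIsomorphism (AbelianGroup.rawGroup G) (AbelianGroup.rawGroup H))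

_⊕_ : AbelianGroup a ℓ₁ → AbelianGroup b ℓ₂ → AbelianGroup (a ⊔ b) (ℓ₁ ⊔ ℓ₂)
_⊕_ = DirectProduct.abelianGroup

-- The index set is finite, so the direct sum is the product.
⨁ : (Fin n → AbelianGroup a ℓ₁) → AbelianGroup a ℓ₁
⨁ {n} G = record
  { Carrier        = (i : Fin n) → Gᵢ.Carrier i
  ; _≈_            = λ x y → ∀ i → Gᵢ._≈_ i (x i) (y i)
  ; _∙_            = λ x y i → Gᵢ._∙_ i (x i) (y i)
  ; ε              = λ i → Gᵢ.ε i
  ; _⁻¹            = λ x i → Gᵢ._⁻¹ i (x i)
  ; isAbelianGroup = record
    { isGroup = record
      { isMonoid = record
        { isSemigroup = record
          { isMagma = record
            { isEquivalence = record
              { refl  = λ i → Gᵢ.refl i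
              ; sym   = λ x≈y i → Gᵢ.sym i (x≈y i)
              ; trans = λ x≈y y≈z i → Gᵢ.trans i (x≈y i) (y≈z i)
              }
            ; ∙-cong = λ x≈y u≈v i → Gᵢ.∙-cong i (x≈y i) (u≈v i)
            }
          ; assoc = λ x y z i → Gᵢ.assoc i (x i) (y i) (z i)
          }
        ; identity = (λ x i → Gᵢ.identityˡ i (x i)) , (λ x i → Gᵢ.identityʳ i (x i))
        }
      ; inverse = (λ x i → Gᵢ.inverseˡ i (x i)) , (λ x i → Gᵢ.inverseʳ i (x i))
      ; ⁻¹-cong = λ x≈y i → Gᵢ.⁻¹-cong i (x≈y i)
      }
    ; comm = λ x y i → Gᵢ.comm i (x i) (y i)
    }
  }
  where module Gᵢ i = AbelianGroup (G i)

record Subgroup (G : AbelianGroup a ℓ₁) p : Set (a ⊔ ℓ₁ ⊔ lsuc p) where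
  open AbelianGroup G
  field
    Member    : Carrier → Set p
    resp      : ∀ {x y} → x ≈ y → Member x → Member y
    ∙-closed  : ∀ {x y} → Member x → Member y → Member (x ∙ y)
    ε-closed  : Member ε
    ⁻¹-closed : ∀ {x} → Member x → Member (x ⁻¹)

⟨_⟩ : {G : AbelianGroup a ℓ₁} → Subgroup G p → AbelianGroup (a ⊔ p) ℓ₁
⟨_⟩ {G = G} N = record
  { Carrier        = ∃ Member
  ; _≈_            = λ x y → proj₁ x ≈ proj₁ y
  ; _∙_            = λ (x , x∈N) (y , y∈N) → x ∙ y , ∙-closed x∈N y∈N
  ; ε              = ε , ε-closed
  ; _⁻¹            = λ (x , x∈N) → x ⁻¹ , ⁻¹-closed x∈N
  ; isAbelianGroup = record
    { isGroup = record
      { isMonoid = record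
        { isSemigroup = record
          { isMagma = record
            { isEquivalence = record { refl = G.refl ; sym = G.sym ; trans = G.trans }
            ; ∙-cong = ∙-cong
            }
          ; assoc = λ (x , _) (y , _) (z , _) → assoc x y z
          }
        ; identity = (λ (x , _) → identityˡ x) , (λ (x , _) → identityʳ x)
        }
      ; inverse = (λ (x , _) → inverseˡ x) , (λ (x , _) → inverseʳ x)
      ; ⁻¹-cong = ⁻¹-cong
      }
    ; comm = λ (x , _) (y , _) → comm x y
    }
  }
  where
  module G = AbelianGroup G
  open G hiding (refl; sym; trans)
  open Subgroup N

infixl 7 _/_

_/_ : (G : AbelianGroup a ℓ₁) → Subgroup G p → AbelianGroup a p
G / N = record
  { Carrier        = Carrier
  ; _≈_            = λ x y → Member (x ∙ y ⁻¹)
  ; _∙_            = _∙_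
  ; ε              = ε
  ; _⁻¹            = _⁻¹
  ; isAbelianGroup = record
    { isGroup = record
      { isMonoid = record
        { isSemigroup = record
          { isMagma = record
            { isEquivalence = record
              { refl  = reflexive G.refl
              ; sym   = λ {x} {y} x~y → resp (flip x y) (⁻¹-closed x~y)
              ; trans = λ {x} {y} {z} x~y y~z → resp (telescope x y z) (∙-closed x~y y~z)
              }
            ; ∙-cong = λ {x} {y} {u} {v} x~y u~v → resp (swap x y u v) (∙-closed x~y u~v)
            }
          ; assoc = λ x y z → reflexive (assoc x y z)
          }
        ; identity = (λ x → reflexive (identityˡ x)) , (λ x → reflexive (identityʳ x))
        }
      ; inverse = (λ x → reflexive (inverseˡ x)) , (λ x → reflexive (inverseʳ x))
      ; ⁻¹-cong = λ {x} {y} x~y → resp (G.sym (⁻¹-∙-comm x (y ⁻¹))) (⁻¹-closed x~y)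
      }
    ; comm = λ x y → reflexive (comm x y)
    }
  }
  where
  module G = AbelianGroup G
  open G hiding (refl; sym; trans; reflexive)
  open Subgroup N
  open AbelianGroupProperties G using (⁻¹-∙-comm; ⁻¹-involutive)
  open import Algebra.Properties.CommutativeSemigroup commutativeSemigroup using (interchange)
  open import Relation.Binary.Reasoning.Setoid setoid

  reflexive : ∀ {x y} → x ≈ y → Member (x ∙ y ⁻¹)
  reflexive {x} {y} x≈y = resp (G.trans (G.sym (inverseʳ y)) (∙-congʳ (G.sym x≈y))) ε-closed

  flip : ∀ x y → (x ∙ y ⁻¹) ⁻¹ ≈ y ∙ x ⁻¹
  flip x y = begin
    (x ∙ y ⁻¹) ⁻¹    ≈⟨ ⁻¹-∙-comm x (y ⁻¹) ⟨
    x ⁻¹ ∙ y ⁻¹ ⁻¹   ≈⟨ ∙-congˡ (⁻¹-involutive y) ⟩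
    x ⁻¹ ∙ y         ≈⟨ comm (x ⁻¹) y ⟩
    y ∙ x ⁻¹         ∎

  telescope : ∀ x y z → (x ∙ y ⁻¹) ∙ (y ∙ z ⁻¹) ≈ x ∙ z ⁻¹
  telescope x y z = begin
    (x ∙ y ⁻¹) ∙ (y ∙ z ⁻¹)  ≈⟨ assoc x (y ⁻¹) (y ∙ z ⁻¹) ⟩
    x ∙ (y ⁻¹ ∙ (y ∙ z ⁻¹))  ≈⟨ ∙-congˡ (assoc (y ⁻¹) y (z ⁻¹)) ⟨
    x ∙ ((y ⁻¹ ∙ y) ∙ z ⁻¹)  ≈⟨ ∙-congˡ (∙-congʳ (inverseˡ y)) ⟩
    x ∙ (ε ∙ z ⁻¹)           ≈⟨ ∙-congˡ (identityˡ (z ⁻¹)) ⟩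
    x ∙ z ⁻¹                 ∎

  swap : ∀ x y u v → (x ∙ y ⁻¹) ∙ (u ∙ v ⁻¹) ≈ (x ∙ u) ∙ (y ∙ v) ⁻¹
  swap x y u v = G.trans (interchange x (y ⁻¹) u (v ⁻¹)) (∙-congˡ (⁻¹-∙-comm y v))

Torsion : (G : AbelianGroup a ℓ₁) → Subgroup G ℓ₁
Torsion G = record
  { Member    = λ x → ∃ λ k → NonZero k × k · x ≈ ε
  ; resp      = λ x≈y (k , k≢0 , kx≈ε) →
                  k , k≢0 , G.trans (×-congʳ k (G.sym x≈y)) kx≈ε
  ; ∙-closed  = λ {x} {y} (k , k≢0 , kx≈ε) (l , l≢0 , ly≈ε) →
                  k ℕ.* l , ℕ.m*n≢0 k l {{k≢0}} {{l≢0}} , (begin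
                    (k ℕ.* l) · (x ∙ y)                ≈⟨ ×-distrib-+ x y (k ℕ.* l) ⟩
                    (k ℕ.* l) · x ∙ (k ℕ.* l) · y      ≈⟨ ∙-congʳ (×-congˡ (ℕ.*-comm k l)) ⟩
                    (l ℕ.* k) · x ∙ (k ℕ.* l) · y      ≈⟨ ∙-cong (kill l k kx≈ε) (kill k l ly≈ε) ⟩
                    ε ∙ ε                              ≈⟨ identityˡ ε ⟩
                    ε                                  ∎)
  ; ε-closed  = 1 , _ , identityˡ ε
  ; ⁻¹-closed = λ {x} (k , k≢0 , kx≈ε) →
                  k , k≢0 , G.trans (·-⁻¹ k x) (G.trans (⁻¹-cong kx≈ε) ε⁻¹≈ε)
  }
  where
  module G = AbelianGroup G
  open G hiding (refl; sym; trans)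
  open RawMonoidDefinitions rawMonoid renaming (_×_ to _·_)
  open Mult commutativeMonoid using (×-congʳ; ×-congˡ; ×-distrib-+; ×-assocˡ)
  open AbelianGroupProperties G using (⁻¹-∙-comm; ε⁻¹≈ε)
  open import Relation.Binary.Reasoning.Setoid setoid

  ·-ε : ∀ k → k · ε ≈ ε
  ·-ε zero    = G.refl
  ·-ε (suc k) = G.trans (identityˡ (k · ε)) (·-ε k)

  kill : ∀ k l {x} → l · x ≈ ε → (k ℕ.* l) · x ≈ ε
  kill k l {x} lx≈ε = begin
    (k ℕ.* l) · x  ≈⟨ ×-assocˡ x k l ⟨
    k · (l · x)    ≈⟨ ×-congʳ k lx≈ε ⟩
    k · ε          ≈⟨ ·-ε k ⟩
    ε              ∎

  ·-⁻¹ : ∀ k x → k · (x ⁻¹) ≈ (k · x) ⁻¹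
  ·-⁻¹ zero    x = G.sym ε⁻¹≈ε
  ·-⁻¹ (suc k) x = G.trans (∙-congˡ (·-⁻¹ k x)) (⁻¹-∙-comm x (k · x))

multiples : ℕ → Subgroup ℤ.+-0-abelianGroup 0ℓ
multiples k = record
  { Member    = λ x → + k ℤ.∣ x
  ; resp      = subst (+ k ℤ.∣_)
  ; ∙-closed  = ℤ.∣m∣n⇒∣m+n
  ; ε-closed  = ℤ.divides 0ℤ refl
  ; ⁻¹-closed = ℤ.∣m⇒∣-m
  }

ℤ/ : ℕ → AbelianGroup 0ℓ 0ℓ
ℤ/ k = ℤ.+-0-abelianGroup / multiples k

ℤ^ : ℕ → AbelianGroup 0ℓ 0ℓ
ℤ^ n = ⨁ {n} (λ _ → ℤ.+-0-abelianGroup)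

Matrix : ℕ → ℕ → Set
Matrix m n = Vector (Vector ℤ n) m

infixr 7 _*ᵥ_

_*ᵥ_ : Matrix m n → Vector ℤ n → Vector ℤ m
(M *ᵥ x) i = ℤΣ.sum (λ j → M i j ℤ.* x j)

*ᵥ-+ : (M : Matrix m n) (x y : Vector ℤ n) → ∀ i →
       (M *ᵥ (λ j → x j ℤ.+ y j)) i ≡ (M *ᵥ x) i ℤ.+ (M *ᵥ y) i
*ᵥ-+ M x y i = trans
  (ℤΣ.sum-cong-≗ (λ j → ℤ.*-distribˡ-+ (M i j) (x j) (y j)))
  (ℤΣ.∑-distrib-+ (λ j → M i j ℤ.* x j) (λ j → M i j ℤ.* y j))

*ᵥ-0 : (M : Matrix m n) → ∀ i → (M *ᵥ (λ _ → 0ℤ)) i ≡ 0ℤ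
*ᵥ-0 {n = n} M i = trans
  (ℤΣ.sum-cong-≗ (λ j → ℤ.*-zeroʳ (M i j)))
  (ℤΣ.sum-replicate-zero n)

*ᵥ-neg : (M : Matrix m n) (x : Vector ℤ n) → ∀ i →
         (M *ᵥ (λ j → ℤ.- x j)) i ≡ ℤ.- (M *ᵥ x) i
*ᵥ-neg M x i = trans
  (ℤΣ.sum-cong-≗ (λ j → trans (sym (ℤ.neg-distribʳ-* (M i j) (x j)))
                              (sym (ℤ.-1*i≡-i (M i j ℤ.* x j)))))
  (trans (sym (ℤΣ.*-distribˡ-sum (ℤ.- (+ 1)) (λ j → M i j ℤ.* x j)))
         (ℤ.-1*i≡-i ((M *ᵥ x) i)))

Image : Matrix m n → Subgroup (ℤ^ m) 0ℓ
Image {n = n} M = record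
  { Member    = λ y → ∃ λ (x : Vector ℤ n) → ∀ i → y i ≡ (M *ᵥ x) i
  ; resp      = λ y≗z (x , y≗Mx) → x , λ i → trans (sym (y≗z i)) (y≗Mx i)
  ; ∙-closed  = λ (x , y≗Mx) (x′ , z≗Mx′) →
                  (λ j → x j ℤ.+ x′ j) ,
                  λ i → trans (cong₂ ℤ._+_ (y≗Mx i) (z≗Mx′ i)) (sym (*ᵥ-+ M x x′ i))
  ; ε-closed  = (λ _ → 0ℤ) , λ i → sym (*ᵥ-0 M i)
  ; ⁻¹-closed = λ (x , y≗Mx) →
                  (λ j → ℤ.- x j) ,
                  λ i → trans (cong ℤ.-_ (y≗Mx i)) (sym (*ᵥ-neg M x i))
  }

Cokernel : Matrix m n → AbelianGroup 0ℓ 0ℓ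
Cokernel {m} M = ℤ^ m / Image M

diag : Vector ℤ n → Matrix n n
diag x i j = if does (i ≟ j) then x i else 0ℤ

-- adj u v is the number of edges joining u and v.
record Multigraph (n : ℕ) : Set where
  field
    adj       : Fin n → Fin n → ℕ
    symmetric : ∀ u v → adj u v ≡ adj v u
    loopless  : ∀ v → adj v v ≡ 0
    connected : ∀ u v → Star (λ x y → NonZero (adj x y)) u v

K : ∀ n → Multigraph n
K n = record
  { adj       = adj
  ; symmetric = symmetric
  ; loopless  = loopless
  ; connected = connected
  }
  where
  adj : Fin n → Fin n → ℕ
  adj u v = if does (u ≟ v) then 0 else 1

  symmetric : ∀ u v → adj u v ≡ adj v u
  symmetric u v with u ≟ v | v ≟ u
  ... | yes _    | yes _    = refl
  ... | no _     | no _     = refl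
  ... | yes refl | no v≢u   = contradiction refl v≢u
  ... | no u≢v   | yes refl = contradiction refl u≢v

  loopless : ∀ v → adj v v ≡ 0
  loopless v with v ≟ v
  ... | yes _  = refl
  ... | no v≢v = contradiction refl v≢v

  edge : ∀ u v → (u ≡ v → NonZero (adj u v)) → NonZero (adj u v)
  edge u v eq with u ≟ v
  ... | yes u≡v = eq u≡v
  ... | no _    = _

  connected : ∀ u v → Star (λ x y → NonZero (adj x y)) u v
  connected u v with u ≟ v
  ... | yes refl = []
  ... | no u≢v   = edge u v (λ u≡v → contradiction u≡v u≢v) ∷ []

record ArithmeticalStructure (G : Multigraph n) : Set where
  open Multigraph G
  field
    d r              : Vector ℕ n
    r-positive       : ∀ v → NonZero (r v)
    -- The empty graph has no arithmetical structure, as k = 0 shows.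
    no-common-factor : ∀ k → (∀ v → k ℕ.∣ r v) → k ≡ 1
    balanced         : ∀ v → r v ℕ.* d v ≡ ℕΣ.sum (λ u → adj v u ℕ.* r u)

Laplacian : Multigraph n → Vector ℕ n → Matrix n n
Laplacian G d u v = diag (λ w → + d w) u v ℤ.- + Multigraph.adj G u v

CriticalGroup : (G : Multigraph n) → ArithmeticalStructure G → AbelianGroup 0ℓ 0ℓ
CriticalGroup G S = ⟨ Torsion (Cokernel (Laplacian G (ArithmeticalStructure.d S))) ⟩

lcms : Vector ℕ n → ℕ
lcms = foldr lcm 1

-- Put mᵢ = dᵢ + 1.  The structure equations say rᵢ mᵢ = Σ r for all i, and
-- since the rᵢ have no common factor, Σ r = ℓ.  The form
-- B(x, y) = Σ rᵢ xᵢ yᵢ mod ℓ is therefore well defined on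
-- H = ⨁ ℤ/mᵢ.  Let e = (1, …, 1) and choose u with Σ rᵢ uᵢ = 1.  Then
-- B(e, e) = 0 and B(e, u) = 1, so e and u span a copy of (ℤ/ℓ)² with a
-- complement in H.  Since L x = (mᵢ xᵢ)ᵢ − (Σ x) e, the torsion classes of
-- coker L are those of the y with Σ rᵢ yᵢ = 0, and y ↦ y − B(u, y) e maps them
-- isomorphically onto that complement.
module Submission where

open import Defs
open import Algebra.Bundles using (AbelianGroup; CommutativeMonoid)
import Algebra.Definitions.RawMonoid as RawMonoidDefinitions
import Algebra.Properties.CommutativeMonoid.Sum as CommutativeMonoidSum
import Algebra.Properties.Group as GroupProperties
open import Data.Bool.Base using (true; false; if_then_else_)
open import Data.Fin.Base using (Fin; zero; suc)
open import Data.Fin.Properties using (_≟_)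
open import Data.Integer.Base as ℤ using (ℤ; +_; 0ℤ; 1ℤ)
open import Data.Integer.Divisibility.Signed using (divides) renaming (_∣_ to _∣ℤ_)
import Data.Integer.Properties as ℤ
open import Data.Integer.Tactic.RingSolver using (solve-∀)
open import Data.Nat.Base as ℕ using (ℕ; zero; suc; NonZero; _+_)
open import Data.Nat.Divisibility using (_∣_; divides; ∣-trans; 1∣_; ∣-reflexive)
open import Data.Nat.GCD using (GCD; module Bézout)
open import Data.Nat.LCM using (m∣lcm[m,n]; n∣lcm[m,n]; lcm-least)
import Data.Nat.Properties as ℕ
open import Data.Product.Base using (∃; _×_; _,_; proj₁; proj₂)
open import Data.Sum.Base using (inj₁; inj₂)
open import Data.Vec.Functional using (Vector; head; tail)
open import Function.Base using (_∘_)
open import Level using (Level)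
open import Relation.Binary.PropositionalEquality
  using (_≡_; refl; sym; trans; cong; cong₂; subst; module ≡-Reasoning)
open import Relation.Nullary using (does; contradiction)

private
  variable
    a b ℓ₁ ℓ₂ : Level
    n : ℕ

-- Isomorphisms of abelian groups from additive maps.

-- f is not assumed to respect ≈: together with additivity, the condition on
-- the class of ε forces it.
≅-byKernel : (G : AbelianGroup a ℓ₁) (H : AbelianGroup b ℓ₂) →
  let module G = AbelianGroup G
      module H = AbelianGroup H
  in (f : G.Carrier → H.Carrier) →
     (∀ x y → f (x G.∙ y) H.≈ f x H.∙ f y) →
     (∀ x → x G.≈ G.ε → f x H.≈ H.ε) →
     (∀ x → f x H.≈ H.ε → x G.≈ G.ε) →
     (∀ y → ∃ λ x → f x H.≈ y) →
     G ≅ H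
≅-byKernel G H f homo ε-cong ε-injective onto = f , record
  { isGroupMonomorphism = record
    { isGroupHomomorphism = record
      { isMonoidHomomorphism = record
        { isMagmaHomomorphism = record
          { isRelHomomorphism = record { cong = f-cong }
          ; homo = homo
          }
        ; ε-homo = ε-cong G.ε G.refl
        }
      ; ⁻¹-homo = ⁻¹-homo
      }
    ; injective = λ {x} {y} fx≈fy → G.x∙y⁻¹≈ε⇒x≈y x y
        (ε-injective _ (H.trans (difference x y) (H.x≈y⇒x∙y⁻¹≈ε fx≈fy)))
    }
  ; surjective = λ y → proj₁ (onto y) , λ z≈x → H.trans (f-cong z≈x) (proj₂ (onto y))
  }
  where
  module G where
    open AbelianGroup G public
    open GroupProperties group public
  module H where
    open AbelianGroup H public
    open GroupProperties group public

  ⁻¹-homo : ∀ x → f (x G.⁻¹) H.≈ f x H.⁻¹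
  ⁻¹-homo x = H.inverseʳ-unique (f x) (f (x G.⁻¹))
    (H.trans (H.sym (homo x (x G.⁻¹))) (ε-cong _ (G.inverseʳ x)))

  difference : ∀ x y → f (x G.∙ y G.⁻¹) H.≈ f x H.∙ f y H.⁻¹
  difference x y = H.trans (homo x (y G.⁻¹)) (H.∙-congˡ (⁻¹-homo y))

  f-cong : ∀ {x y} → x G.≈ y → f x H.≈ f y
  f-cong {x} {y} x≈y = H.x∙y⁻¹≈ε⇒x≈y (f x) (f y)
    (H.trans (H.sym (difference x y)) (ε-cong _ (G.x≈y⇒x∙y⁻¹≈ε x≈y)))

-- Sums with a single nonzero term.

module _ (M : CommutativeMonoid a ℓ₁) where
  open CommutativeMonoid M using (Carrier; _≈_; ε; ∙-congˡ; identityˡ; identityʳ)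
    renaming (trans to ≈-trans)
  open CommutativeMonoidSum M

  -- Stated over any commutative monoid so that it serves both the structure equations in ℕ and the
  -- diagonal of the Laplacian in ℤ.
  sum-select : (i : Fin n) (x : Vector Carrier n) →
               sum (λ j → if does (i ≟ j) then x j else ε) ≈ x i
  sum-select {n = suc n} zero x =
    ≈-trans (∙-congˡ (sum-replicate-zero n)) (identityʳ (x zero))
  sum-select (suc i) x =
    ≈-trans (identityˡ _) (sum-select i (tail x))

-- Least common multiples and complementary divisors.

∣lcms : (m : Vector ℕ n) → ∀ i → m i ∣ lcms m
∣lcms m zero    = m∣lcm[m,n] (head m) (lcms (tail m))
∣lcms m (suc i) = ∣-trans (∣lcms (tail m) i) (n∣lcm[m,n] (head m) (lcms (tail m)))

lcms-least : (m : Vector ℕ n) {k : ℕ} → (∀ i → m i ∣ k) → lcms m ∣ k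
lcms-least {zero}  m m∣k = 1∣ _
lcms-least {suc n} m m∣k = lcm-least (m∣k zero) (lcms-least (tail m) (m∣k ∘ suc))

module _ {r m : Vector ℕ n} {k : ℕ}
  (coprime : ∀ q → (∀ i → q ∣ r i) → q ≡ 1)
  (r*m≡k : ∀ i → r i ℕ.* m i ≡ k)
  (m≢0 : ∀ i → NonZero (m i))
  where

  -- As a common multiple of the `m i`, `k` equals `q * lcms m` for some `q`. Writing `lcms m` as
  -- `t * m i` and cancelling `m i` gives `r i ≡ t * q`, so `q` is a common factor of the `r i` and
  -- must be 1.
  lcms-complement : lcms m ≡ k
  lcms-complement with lcms-least m (λ i → divides (r i) (sym (r*m≡k i)))
  ... | divides q k≡q*ℓ = sym (begin
    k             ≡⟨ k≡q*ℓ ⟩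
    q ℕ.* lcms m  ≡⟨ cong (ℕ._* lcms m) (coprime q q∣r) ⟩
    1 ℕ.* lcms m  ≡⟨ ℕ.*-identityˡ (lcms m) ⟩
    lcms m        ∎)
    where
    open ≡-Reasoning
    q∣r : ∀ i → q ∣ r i
    q∣r i with ∣lcms m i
    ... | divides t ℓ≡t*m = divides t (ℕ.*-cancelʳ-≡ (r i) (t ℕ.* q) (m i) {{m≢0 i}} (begin
      r i ℕ.* m i          ≡⟨ r*m≡k i ⟩
      k                    ≡⟨ k≡q*ℓ ⟩
      q ℕ.* lcms m         ≡⟨ cong (q ℕ.*_) ℓ≡t*m ⟩
      q ℕ.* (t ℕ.* m i)    ≡⟨ ℕ.*-assoc q t (m i) ⟨
      q ℕ.* t ℕ.* m i      ≡⟨ cong (ℕ._* m i) (ℕ.*-comm q t) ⟩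
      t ℕ.* q ℕ.* m i      ∎))

  complement≢0 : NonZero k
  complement≢0 = ℕ.≢-nonZero λ k≡0 →
    -- If `k` were 0, every `r i` would vanish and 0 would be a common factor. For `n = 0` the same
    -- instance holds vacuously.
    contradiction (coprime 0 (λ i → ∣-reflexive (sym (r≡0 k≡0 i)))) λ ()
    where
    r≡0 : k ≡ 0 → ∀ i → r i ≡ 0
    r≡0 k≡0 i with ℕ.m*n≡0⇒m≡0∨n≡0 (r i) (trans (r*m≡k i) k≡0)
    ... | inj₁ rᵢ≡0 = rᵢ≡0
    ... | inj₂ mᵢ≡0 = contradiction mᵢ≡0 (ℕ.≢-nonZero⁻¹ (m i) {{m≢0 i}})

-- Integer dot products.

infix 9 _·_

_·_ : Vector ℤ n → Vector ℤ n → ℤ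
x · y = ℤΣ.sum (λ i → x i ℤ.* y i)

𝟙 : Vector ℤ n
𝟙 _ = 1ℤ

·-congʳ : (x : Vector ℤ n) {y z : Vector ℤ n} → (∀ i → y i ≡ z i) → x · y ≡ x · z
·-congʳ x y≗z = ℤΣ.sum-cong-≗ (λ i → cong (x i ℤ.*_) (y≗z i))

·-+ : (x y z : Vector ℤ n) → x · (λ i → y i ℤ.+ z i) ≡ x · y ℤ.+ x · z
·-+ x y z = *ᵥ-+ {m = 1} (λ _ → x) y z zero

·-* : (x : Vector ℤ n) (c : ℤ) (y : Vector ℤ n) → x · (λ i → c ℤ.* y i) ≡ c ℤ.* x · y
·-* x c y = trans (ℤΣ.sum-cong-≗ (λ i → swap (x i) c (y i)))
  (sym (ℤΣ.*-distribˡ-sum c (λ i → x i ℤ.* y i)))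
  where
  swap : ∀ x c y → x ℤ.* (c ℤ.* y) ≡ c ℤ.* (x ℤ.* y)
  swap = solve-∀

-- The shape shared by `L *ᵥ x`, `embed` and the witnesses below: a vector plus a multiple of a
-- fixed one.
·-+* : (x y : Vector ℤ n) (c : ℤ) (z : Vector ℤ n) →
       x · (λ i → y i ℤ.+ c ℤ.* z i) ≡ x · y ℤ.+ c ℤ.* x · z
·-+* x y c z = trans (·-+ x y (λ i → c ℤ.* z i)) (cong (λ e → x · y ℤ.+ e) (·-* x c z))

·𝟙 : (x : Vector ℤ n) → x · 𝟙 ≡ ℤΣ.sum x
·𝟙 x = ℤΣ.sum-cong-≗ (λ i → ℤ.*-identityʳ (x i))

𝟙· : (x : Vector ℤ n) → 𝟙 · x ≡ ℤΣ.sum x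
𝟙· x = ℤΣ.sum-cong-≗ (λ i → ℤ.*-identityˡ (x i))

pos-sum : (x : Vector ℕ n) → + ℕΣ.sum x ≡ ℤΣ.sum (λ i → + x i)
pos-sum {zero}  x = refl
pos-sum {suc n} x = trans (ℤ.pos-+ (head x) (ℕΣ.sum (tail x)))
                          (cong (λ e → + head x ℤ.+ e) (pos-sum (tail x)))

-- Bézout coefficients for a vector.

-- Moves the subtraction-free Bézout identity from ℕ to ℤ. Its mirror image is the same statement
-- with `m` and `n` exchanged.
bezout-difference : ∀ g m n x y → g + y ℕ.* n ≡ x ℕ.* m →
                    + m ℤ.* + x ℤ.+ + n ℤ.* ℤ.- + y ≡ + g
bezout-difference g m n x y eq = begin
  + m ℤ.* + x ℤ.+ + n ℤ.* ℤ.- + y        ≡⟨ swap (+ m) (+ n) (+ x) (+ y) ⟩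
  + x ℤ.* + m ℤ.- + y ℤ.* + n            ≡⟨ cong₂ ℤ._-_ (ℤ.pos-* x m) (ℤ.pos-* y n) ⟨
  + (x ℕ.* m) ℤ.- + (y ℕ.* n)            ≡⟨ cong (λ z → + z ℤ.- + (y ℕ.* n)) eq ⟨
  + g ℤ.+ + (y ℕ.* n) ℤ.- + (y ℕ.* n)    ≡⟨ cancel (+ g) (+ (y ℕ.* n)) ⟩
  + g                                    ∎
  where
  open ≡-Reasoning
  swap : ∀ m n x y → m ℤ.* x ℤ.+ n ℤ.* ℤ.- y ≡ x ℤ.* m ℤ.- y ℤ.* n
  swap = solve-∀
  cancel : ∀ g z → g ℤ.+ z ℤ.- z ≡ g
  cancel = solve-∀

bezout₂ : (m n : ℕ) → ∃ λ g → ∃ λ x → ∃ λ y →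
          (g ∣ m × g ∣ n) × + m ℤ.* x ℤ.+ + n ℤ.* y ≡ + g
bezout₂ m n with Bézout.lemma m n
... | Bézout.result g gcd (Bézout.+- x y eq) =
  g , + x , ℤ.- + y , GCD.commonDivisor gcd , bezout-difference g m n x y eq
... | Bézout.result g gcd (Bézout.-+ x y eq) =
  g , ℤ.- + x , + y , GCD.commonDivisor gcd ,
  trans (ℤ.+-comm (+ m ℤ.* ℤ.- + x) (+ n ℤ.* + y)) (bezout-difference g n m y x eq)

-- By induction: `bezout₂` combines the head with the divisor found for the tail, whose coefficients
-- are scaled by `y`. That `g` divides each entry is what later lets `no-common-factor` turn it into
-- 1.
bezout : (r : Vector ℕ n) → ∃ λ g → ∃ λ u →
         (∀ i → g ∣ r i) × (λ i → + r i) · u ≡ + g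
-- The value 0 is forced by the empty sum.
bezout {zero}  r = 0 , (λ ()) , (λ ()) , refl
bezout {suc n} r with bezout (tail r)
... | g′ , u′ , g′∣r , r·u′≡g′ with bezout₂ (head r) g′
... | g , x , y , (g∣r₀ , g∣g′) , r₀x+g′y≡g =
  g , u , g∣r , (begin
    + head r ℤ.* x ℤ.+ (λ i → + tail r i) · (λ i → y ℤ.* u′ i)
      ≡⟨ cong (λ e → + head r ℤ.* x ℤ.+ e) (·-* (λ i → + tail r i) y u′) ⟩
    + head r ℤ.* x ℤ.+ y ℤ.* (λ i → + tail r i) · u′
      ≡⟨ cong (λ z → + head r ℤ.* x ℤ.+ y ℤ.* z) r·u′≡g′ ⟩
    + head r ℤ.* x ℤ.+ y ℤ.* + g′
      ≡⟨ cong (λ e → + head r ℤ.* x ℤ.+ e) (ℤ.*-comm y (+ g′)) ⟩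
    + head r ℤ.* x ℤ.+ + g′ ℤ.* y
      ≡⟨ r₀x+g′y≡g ⟩
    + g ∎)
  where
  open ≡-Reasoning
  u : Vector ℤ (suc n)
  u zero    = x
  u (suc i) = y ℤ.* u′ i
  g∣r : ∀ i → g ∣ r i
  g∣r zero    = g∣r₀
  g∣r (suc i) = ∣-trans g∣g′ (g′∣r i)

-- Structure equations on `K n`.

module _ {n} (S : ArithmeticalStructure (K n)) where
  open ArithmeticalStructure S
  open Multigraph (K n) using (adj)
  open ≡-Reasoning

  private
    m : Vector ℕ n
    m i = d i + 1

    Λ : ℤ
    Λ = + lcms m

    ρ μ : Vector ℤ n
    ρ i = + r i
    μ i = + m i

    L : Matrix n n
    L = Laplacian (K n) d

    m≢0 : ∀ i → NonZero (m i)
    m≢0 i = subst NonZero (ℕ.+-comm 1 (d i)) _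

  -- The neighbours of `v` are all the other vertices, so adding `r v` to the balance equation
  -- supplies the one missing term.
  r*m≡∑r : ∀ v → r v ℕ.* m v ≡ ℕΣ.sum r
  r*m≡∑r v = begin
    r v ℕ.* (d v + 1)
      ≡⟨ ℕ.*-distribˡ-+ (r v) (d v) 1 ⟩
    r v ℕ.* d v + r v ℕ.* 1
      ≡⟨ cong₂ _+_ (balanced v) (trans (ℕ.*-identityʳ (r v)) (sym (sum-select ℕ.+-0-commutativeMonoid v r))) ⟩
    ℕΣ.sum (λ u → adj v u ℕ.* r u) + ℕΣ.sum (λ u → if does (v ≟ u) then r u else 0)
      ≡⟨ ℕΣ.∑-distrib-+ (λ u → adj v u ℕ.* r u) (λ u → if does (v ≟ u) then r u else 0) ⟨
    ℕΣ.sum (λ u → adj v u ℕ.* r u + (if does (v ≟ u) then r u else 0))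
      ≡⟨ ℕΣ.sum-cong-≗ merge ⟩
    ℕΣ.sum r ∎
    where
    merge : ∀ u → adj v u ℕ.* r u + (if does (v ≟ u) then r u else 0) ≡ r u
    merge u with does (v ≟ u)
    ... | true  = refl
    ... | false = trans (ℕ.+-identityʳ _) (ℕ.*-identityˡ (r u))

  private
    lcms≡∑r : lcms m ≡ ℕΣ.sum r
    lcms≡∑r = lcms-complement no-common-factor r*m≡∑r m≢0

    lcms≢0 : NonZero (lcms m)
    lcms≢0 = subst NonZero (sym lcms≡∑r) (complement≢0 no-common-factor r*m≡∑r m≢0)

    ρμ≡Λ : ∀ i → ρ i ℤ.* μ i ≡ Λ
    ρμ≡Λ i = trans (sym (ℤ.pos-* (r i) (m i))) (cong +_ (trans (r*m≡∑r i) (sym lcms≡∑r)))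

    ρ·𝟙≡Λ : ρ · 𝟙 ≡ Λ
    ρ·𝟙≡Λ = trans (·𝟙 ρ) (trans (sym (pos-sum r)) (cong +_ (sym lcms≡∑r)))

    bezout-ρ : ∃ λ u → ρ · u ≡ 1ℤ
    bezout-ρ with bezout r
    ... | g , u , g∣r , ρ·u≡g = u , trans ρ·u≡g (cong +_ (no-common-factor g g∣r))

    -- w · y lifts B(u, y).
    u w : Vector ℤ n
    u = proj₁ bezout-ρ
    w i = ρ i ℤ.* u i

    ρ·u≡1 : ρ · u ≡ 1ℤ
    ρ·u≡1 = proj₂ bezout-ρ

    -- The sum of `w` unfolds to `ρ · u`.
    w·𝟙≡1 : w · 𝟙 ≡ 1ℤ
    w·𝟙≡1 = trans (·𝟙 w) ρ·u≡1

  -- The Laplacian and its pairings with `ρ` and `w`.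

  -- The adjacency matrix is the all-ones matrix minus the identity, so `L` is `diag μ` minus the
  -- all-ones matrix.
  laplacian-*ᵥ : ∀ x i → (L *ᵥ x) i ≡ μ i ℤ.* x i ℤ.+ ℤ.- ℤΣ.sum x ℤ.* 1ℤ
  laplacian-*ᵥ x i = begin
    ℤΣ.sum (λ j → L i j ℤ.* x j)
      ≡⟨ ℤΣ.sum-cong-≗ split ⟩
    ℤΣ.sum (λ j → δμx j ℤ.+ ℤ.- 1ℤ ℤ.* x j)
      ≡⟨ ℤΣ.∑-distrib-+ δμx (λ j → ℤ.- 1ℤ ℤ.* x j) ⟩
    ℤΣ.sum δμx ℤ.+ ℤΣ.sum (λ j → ℤ.- 1ℤ ℤ.* x j)
      ≡⟨ cong₂ ℤ._+_ (sum-select ℤ.+-0-commutativeMonoid i (λ j → μ i ℤ.* x j))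
                     (sym (ℤΣ.*-distribˡ-sum (ℤ.- 1ℤ) x)) ⟩
    μ i ℤ.* x i ℤ.+ ℤ.- 1ℤ ℤ.* ℤΣ.sum x
      ≡⟨ tidy (μ i ℤ.* x i) (ℤΣ.sum x) ⟩
    μ i ℤ.* x i ℤ.+ ℤ.- ℤΣ.sum x ℤ.* 1ℤ ∎
    where
    δμx : Vector ℤ n
    δμx j = if does (i ≟ j) then μ i ℤ.* x j else 0ℤ
    tidy : ∀ y z → y ℤ.+ ℤ.- 1ℤ ℤ.* z ≡ y ℤ.+ ℤ.- z ℤ.* 1ℤ
    tidy = solve-∀
    diagonal : ∀ d x → (d ℤ.- 0ℤ) ℤ.* x ≡ (d ℤ.+ 1ℤ) ℤ.* x ℤ.+ ℤ.- 1ℤ ℤ.* x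
    diagonal = solve-∀
    split : ∀ j → L i j ℤ.* x j ≡ δμx j ℤ.+ ℤ.- 1ℤ ℤ.* x j
    split j with does (i ≟ j)
    ... | true  = diagonal (+ d i) (x j)
    ... | false = sym (ℤ.+-identityˡ _)

  private
    -- Weighting by `ρ` turns `diag μ` into the scalar `Λ`.
    ρ·μx : ∀ x → ρ · (λ i → μ i ℤ.* x i) ≡ Λ ℤ.* ℤΣ.sum x
    ρ·μx x = trans
      (ℤΣ.sum-cong-≗ λ i → trans (sym (ℤ.*-assoc (ρ i) (μ i) (x i))) (cong (ℤ._* x i) (ρμ≡Λ i)))
      (sym (ℤΣ.*-distribˡ-sum Λ x))

    w·μx : ∀ x → w · (λ i → μ i ℤ.* x i) ≡ Λ ℤ.* u · x
    w·μx x = trans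
      (ℤΣ.sum-cong-≗ λ i → trans (regroup (ρ i) (u i) (μ i) (x i)) (cong (ℤ._* (u i ℤ.* x i)) (ρμ≡Λ i)))
      (sym (ℤΣ.*-distribˡ-sum Λ (λ i → u i ℤ.* x i)))
      where
      regroup : ∀ ρ u μ x → ρ ℤ.* u ℤ.* (μ ℤ.* x) ≡ ρ ℤ.* μ ℤ.* (u ℤ.* x)
      regroup = solve-∀

    ·L : ∀ a x → a · (L *ᵥ x) ≡ a · (λ i → μ i ℤ.* x i) ℤ.+ ℤ.- ℤΣ.sum x ℤ.* a · 𝟙
    ·L a x = trans (·-congʳ a (laplacian-*ᵥ x)) (·-+* a (λ i → μ i ℤ.* x i) (ℤ.- ℤΣ.sum x) 𝟙)

    -- As `L` is symmetric, this is `L r = 0` transposed.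
    ρ·L≡0 : ∀ x → ρ · (L *ᵥ x) ≡ 0ℤ
    ρ·L≡0 x = begin
      ρ · (L *ᵥ x)
        ≡⟨ ·L ρ x ⟩
      ρ · (λ i → μ i ℤ.* x i) ℤ.+ ℤ.- ℤΣ.sum x ℤ.* ρ · 𝟙
        ≡⟨ cong₂ (λ y z → y ℤ.+ ℤ.- ℤΣ.sum x ℤ.* z) (ρ·μx x) ρ·𝟙≡Λ ⟩
      Λ ℤ.* ℤΣ.sum x ℤ.+ ℤ.- ℤΣ.sum x ℤ.* Λ
        ≡⟨ cancel Λ (ℤΣ.sum x) ⟩
      0ℤ ∎
      where
      cancel : ∀ y z → y ℤ.* z ℤ.+ ℤ.- z ℤ.* y ≡ 0ℤ
      cancel = solve-∀

    -- Modulo `Λ`, pairing with `w` recovers the coefficient of `𝟙` in `L *ᵥ x`; this is why `embed`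
    -- subtracts `w · y`.
    w·L : ∀ x → w · (L *ᵥ x) ≡ Λ ℤ.* u · x ℤ.- ℤΣ.sum x
    w·L x = begin
      w · (L *ᵥ x)
        ≡⟨ ·L w x ⟩
      w · (λ i → μ i ℤ.* x i) ℤ.+ ℤ.- ℤΣ.sum x ℤ.* w · 𝟙
        ≡⟨ cong₂ (λ y z → y ℤ.+ ℤ.- ℤΣ.sum x ℤ.* z) (w·μx x) w·𝟙≡1 ⟩
      Λ ℤ.* u · x ℤ.+ ℤ.- ℤΣ.sum x ℤ.* 1ℤ
        ≡⟨ cong (λ e → Λ ℤ.* u · x ℤ.+ e) (ℤ.*-identityʳ (ℤ.- ℤΣ.sum x)) ⟩
      Λ ℤ.* u · x ℤ.- ℤΣ.sum x ∎

    -- Torsion classes as the vectors orthogonal to `ρ`.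

    open RawMonoidDefinitions (AbelianGroup.rawMonoid (Cokernel L)) renaming (_×_ to _×ᶜ_)
    open Subgroup (Torsion (Cokernel L)) renaming (Member to IsTorsion) using ()

    ×ᶜ-* : ∀ k y i → (k ×ᶜ y) i ≡ + k ℤ.* y i
    ×ᶜ-* zero    y i = refl
    ×ᶜ-* (suc k) y i = trans (cong (λ e → y i ℤ.+ e) (×ᶜ-* k y i)) (sym (ℤ.suc-* (+ k) (y i)))

  -- Pairing `k y = L x` with `ρ` kills the right side, and ℤ has no zero divisors.
  torsion⇒ρ·≡0 : ∀ {y} → IsTorsion y → ρ · y ≡ 0ℤ
  torsion⇒ρ·≡0 {y} (k , k≢0 , x , ky≡Lx) with ℤ.i*j≡0⇒i≡0∨j≡0 (+ k) k*ρ·y≡0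
    where
    k*ρ·y≡0 : + k ℤ.* ρ · y ≡ 0ℤ
    k*ρ·y≡0 = begin
      + k ℤ.* ρ · y            ≡⟨ ·-* ρ (+ k) y ⟨
      -- Being `ε` in the cokernel means that `k y - 0` lies in the image, and `- 0ℤ` reduces to
      -- `0ℤ`; hence `+-identityʳ` here and below.
      ρ · (λ i → + k ℤ.* y i)  ≡⟨ ·-congʳ ρ (λ i → trans (sym (×ᶜ-* k y i))
                                    (trans (sym (ℤ.+-identityʳ _)) (ky≡Lx i))) ⟩
      ρ · (L *ᵥ x)             ≡⟨ ρ·L≡0 x ⟩
      0ℤ                       ∎
  ... | inj₁ k≡0   = contradiction (ℤ.+-injective k≡0) (ℕ.≢-nonZero⁻¹ k {{k≢0}})
  ... | inj₂ ρ·y≡0 = ρ·y≡0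

  -- `Λ` annihilates the class: for `x i = ρ i * y i` the sum of `x` is `ρ · y`, which is 0, so
  -- `L *ᵥ x` reduces to `μ i * ρ i * y i`, that is, `Λ * y i`.
  ρ·≡0⇒torsion : ∀ {y} → ρ · y ≡ 0ℤ → IsTorsion y
  ρ·≡0⇒torsion {y} ρ·y≡0 = lcms m , lcms≢0 , x , λ i → begin
    (lcms m ×ᶜ y) i ℤ.+ 0ℤ                  ≡⟨ ℤ.+-identityʳ _ ⟩
    (lcms m ×ᶜ y) i                         ≡⟨ ×ᶜ-* (lcms m) y i ⟩
    Λ ℤ.* y i                               ≡⟨ cong (ℤ._* y i) (ρμ≡Λ i) ⟨
    ρ i ℤ.* μ i ℤ.* y i                     ≡⟨ regroup (ρ i) (μ i) (y i) ⟩
    μ i ℤ.* x i ℤ.+ ℤ.- 0ℤ ℤ.* 1ℤ           ≡⟨ cong (λ z → μ i ℤ.* x i ℤ.+ ℤ.- z ℤ.* 1ℤ) ρ·y≡0 ⟨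
    μ i ℤ.* x i ℤ.+ ℤ.- ℤΣ.sum x ℤ.* 1ℤ     ≡⟨ laplacian-*ᵥ x i ⟨
    (L *ᵥ x) i                              ∎
    where
    x : Vector ℤ n
    x i = ρ i ℤ.* y i
    regroup : ∀ ρ μ y → ρ ℤ.* μ ℤ.* y ≡ μ ℤ.* (ρ ℤ.* y) ℤ.+ 0ℤ
    regroup = solve-∀

  -- The map to the sum of cyclic groups, its kernel and its image.

  -- The terms * 1ℤ are coefficients of 𝟙, kept so that ·-+* applies.
  embed : Vector ℤ n → ℤ → ℤ → Vector ℤ n
  embed y s t i = y i ℤ.+ (s ℤ.- w · y) ℤ.* 1ℤ ℤ.+ t ℤ.* u i

  embed-+ : ∀ y y′ s s′ t t′ i →
    embed (λ j → y j ℤ.+ y′ j) (s ℤ.+ s′) (t ℤ.+ t′) i ≡ embed y s t i ℤ.+ embed y′ s′ t′ i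
  embed-+ y y′ s s′ t t′ i = trans
    (cong (λ z → y i ℤ.+ y′ i ℤ.+ (s ℤ.+ s′ ℤ.- z) ℤ.* 1ℤ ℤ.+ (t ℤ.+ t′) ℤ.* u i) (·-+ w y y′))
    (regroup (y i) (y′ i) s s′ t t′ (w · y) (w · y′) (u i))
    where
    regroup : ∀ y y′ s s′ t t′ b b′ u →
      y ℤ.+ y′ ℤ.+ (s ℤ.+ s′ ℤ.- (b ℤ.+ b′)) ℤ.* 1ℤ ℤ.+ (t ℤ.+ t′) ℤ.* u ≡
      y ℤ.+ (s ℤ.- b) ℤ.* 1ℤ ℤ.+ t ℤ.* u ℤ.+ (y′ ℤ.+ (s′ ℤ.- b′) ℤ.* 1ℤ ℤ.+ t′ ℤ.* u)
    regroup = solve-∀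

  ·embed : ∀ a y s t → a · embed y s t ≡ a · y ℤ.+ (s ℤ.- w · y) ℤ.* a · 𝟙 ℤ.+ t ℤ.* a · u
  ·embed a y s t = trans
    (·-+* a (λ i → y i ℤ.+ (s ℤ.- w · y) ℤ.* 1ℤ) t u)
    (cong (ℤ._+ (t ℤ.* a · u)) (·-+* a y (s ℤ.- w · y) 𝟙))

  -- The correction `- w · y` cancels the rank-one part of `L *ᵥ x` modulo `Λ`. What remains is
  -- `μ i * x i` plus a multiple of `Λ`, and `Λ` is `ρ i * μ i`.
  embed-vanishes : ∀ {y x s t} → (∀ i → y i ≡ (L *ᵥ x) i) → Λ ∣ℤ s → Λ ∣ℤ t →
                   ∀ i → μ i ∣ℤ embed y s t i
  embed-vanishes {y} {x} {s} {t} y≡Lx (divides p s≡pΛ) (divides q t≡qΛ) i =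
    divides (x i ℤ.+ (p ℤ.- u · x ℤ.+ q ℤ.* u i) ℤ.* ρ i) (begin
      y i ℤ.+ (s ℤ.- w · y) ℤ.* 1ℤ ℤ.+ t ℤ.* u i
        ≡⟨ cong₂ (λ a b → a ℤ.+ (s ℤ.- b) ℤ.* 1ℤ ℤ.+ t ℤ.* u i)
             (trans (y≡Lx i) (laplacian-*ᵥ x i)) (trans (·-congʳ w y≡Lx) (w·L x)) ⟩
      μ i ℤ.* x i ℤ.+ ℤ.- σ ℤ.* 1ℤ ℤ.+ (s ℤ.- (Λ ℤ.* u · x ℤ.- σ)) ℤ.* 1ℤ ℤ.+ t ℤ.* u i
        ≡⟨ cong₂ (λ a b → μ i ℤ.* x i ℤ.+ ℤ.- σ ℤ.* 1ℤ ℤ.+ (a ℤ.- (Λ ℤ.* u · x ℤ.- σ)) ℤ.* 1ℤ ℤ.+ b ℤ.* u i)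
             s≡pΛ t≡qΛ ⟩
      μ i ℤ.* x i ℤ.+ ℤ.- σ ℤ.* 1ℤ ℤ.+ (p ℤ.* Λ ℤ.- (Λ ℤ.* u · x ℤ.- σ)) ℤ.* 1ℤ ℤ.+ q ℤ.* Λ ℤ.* u i
        ≡⟨ factor (μ i) (x i) σ p Λ (u · x) q (u i) ⟩
      x i ℤ.* μ i ℤ.+ (p ℤ.- u · x ℤ.+ q ℤ.* u i) ℤ.* Λ
        ≡⟨ cong (λ z → x i ℤ.* μ i ℤ.+ (p ℤ.- u · x ℤ.+ q ℤ.* u i) ℤ.* z) (ρμ≡Λ i) ⟨
      x i ℤ.* μ i ℤ.+ (p ℤ.- u · x ℤ.+ q ℤ.* u i) ℤ.* (ρ i ℤ.* μ i)
        ≡⟨ collect (x i) (μ i) (p ℤ.- u · x ℤ.+ q ℤ.* u i) (ρ i) ⟩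
      (x i ℤ.+ (p ℤ.- u · x ℤ.+ q ℤ.* u i) ℤ.* ρ i) ℤ.* μ i ∎)
    where
    σ : ℤ
    σ = ℤΣ.sum x
    factor : ∀ μ x σ p Λ b q u →
      μ ℤ.* x ℤ.+ ℤ.- σ ℤ.* 1ℤ ℤ.+ (p ℤ.* Λ ℤ.- (Λ ℤ.* b ℤ.- σ)) ℤ.* 1ℤ ℤ.+ q ℤ.* Λ ℤ.* u ≡
      x ℤ.* μ ℤ.+ (p ℤ.- b ℤ.+ q ℤ.* u) ℤ.* Λ
    factor = solve-∀
    collect : ∀ x μ c ρ → x ℤ.* μ ℤ.+ c ℤ.* (ρ ℤ.* μ) ≡ (x ℤ.+ c ℤ.* ρ) ℤ.* μ
    collect = solve-∀

  -- Pairing embed y s t with 𝟙 and with u reads off t and s modulo Λ.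
  embed-injective : ∀ {y s t} → ρ · y ≡ 0ℤ → (∀ i → μ i ∣ℤ embed y s t i) →
    (∃ λ x → ∀ i → y i ≡ (L *ᵥ x) i) × Λ ∣ℤ s × Λ ∣ℤ t
  embed-injective {y} {s} {t} ρ·y≡0 μ∣embed =
    (x , y≡Lx) , divides (u · q ℤ.- τ ℤ.* w · u) s≡ , divides τ t≡
    where
    q x : Vector ℤ n
    q i = _∣ℤ_.quotient (μ∣embed i)
    embed≡μq : ∀ i → embed y s t i ≡ μ i ℤ.* q i
    embed≡μq i = trans (_∣ℤ_.equality (μ∣embed i)) (ℤ.*-comm (q i) (μ i))
    c τ : ℤ
    c = s ℤ.- w · y
    τ = ℤΣ.sum q ℤ.- c
    -- Solving `embed y s t i ≡ μ i * q i` for `y i`, with `t ≡ τ * (ρ i * μ i)`, leaves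
    -- `μ i * x i - c`. This is `(L *ᵥ x) i` once `x` sums to `c`; since `w` sums to 1, the choice
    -- of `τ` ensures that.
    x i = q i ℤ.+ ℤ.- τ ℤ.* w i

    -- The dot product with `ρ` lifts `B` against `𝟙`: it kills `y`, sends `𝟙` to `Λ` and `u` to 1.
    t≡ : t ≡ τ ℤ.* Λ
    t≡ = begin
      t
        ≡⟨ isolate c t Λ ⟩
      0ℤ ℤ.+ c ℤ.* Λ ℤ.+ t ℤ.* 1ℤ ℤ.- c ℤ.* Λ
        ≡⟨ cong (ℤ._- c ℤ.* Λ) (cong₂ ℤ._+_ (cong₂ (λ a b → a ℤ.+ c ℤ.* b) ρ·y≡0 ρ·𝟙≡Λ)
             (cong (t ℤ.*_) ρ·u≡1)) ⟨
      ρ · y ℤ.+ c ℤ.* ρ · 𝟙 ℤ.+ t ℤ.* ρ · u ℤ.- c ℤ.* Λ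
        ≡⟨ cong (ℤ._- c ℤ.* Λ) (trans (sym (·embed ρ y s t)) (trans (·-congʳ ρ embed≡μq) (ρ·μx q))) ⟩
      Λ ℤ.* ℤΣ.sum q ℤ.- c ℤ.* Λ
        ≡⟨ collect Λ (ℤΣ.sum q) c ⟩
      τ ℤ.* Λ ∎
      where
      isolate : ∀ c t Λ → t ≡ 0ℤ ℤ.+ c ℤ.* Λ ℤ.+ t ℤ.* 1ℤ ℤ.- c ℤ.* Λ
      isolate = solve-∀
      collect : ∀ Λ σ c → Λ ℤ.* σ ℤ.- c ℤ.* Λ ≡ (σ ℤ.- c) ℤ.* Λ
      collect = solve-∀

    -- The dot product with `w` lifts `B` against `u`. As `w · u` need not vanish, `t * w · u` is
    -- subtracted; `t≡` makes it a multiple of `Λ`.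
    s≡ : s ≡ (u · q ℤ.- τ ℤ.* w · u) ℤ.* Λ
    s≡ = begin
      s
        ≡⟨ isolate s (w · y) (t ℤ.* w · u) ⟩
      w · y ℤ.+ c ℤ.* 1ℤ ℤ.+ t ℤ.* w · u ℤ.- t ℤ.* w · u
        ≡⟨ cong (λ z → w · y ℤ.+ c ℤ.* z ℤ.+ t ℤ.* w · u ℤ.- t ℤ.* w · u) w·𝟙≡1 ⟨
      w · y ℤ.+ c ℤ.* w · 𝟙 ℤ.+ t ℤ.* w · u ℤ.- t ℤ.* w · u
        ≡⟨ cong (ℤ._- (t ℤ.* w · u)) (trans (sym (·embed w y s t)) (trans (·-congʳ w embed≡μq) (w·μx q))) ⟩
      Λ ℤ.* u · q ℤ.- t ℤ.* w · u
        ≡⟨ cong (λ z → Λ ℤ.* u · q ℤ.- z ℤ.* w · u) t≡ ⟩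
      Λ ℤ.* u · q ℤ.- τ ℤ.* Λ ℤ.* w · u
        ≡⟨ collect Λ (u · q) τ (w · u) ⟩
      (u · q ℤ.- τ ℤ.* w · u) ℤ.* Λ ∎
      where
      isolate : ∀ s b z → s ≡ b ℤ.+ (s ℤ.- b) ℤ.* 1ℤ ℤ.+ z ℤ.- z
      isolate = solve-∀
      collect : ∀ Λ a τ b → Λ ℤ.* a ℤ.- τ ℤ.* Λ ℤ.* b ≡ (a ℤ.- τ ℤ.* b) ℤ.* Λ
      collect = solve-∀

    ∑x≡c : ℤΣ.sum x ≡ c
    ∑x≡c = begin
      ℤΣ.sum x                                     ≡⟨ 𝟙· x ⟨
      𝟙 · x                                        ≡⟨ ·-+* 𝟙 q (ℤ.- τ) w ⟩
      𝟙 · q ℤ.+ ℤ.- τ ℤ.* 𝟙 · w                    ≡⟨ cong₂ (λ a b → a ℤ.+ ℤ.- τ ℤ.* b) (𝟙· q) (trans (𝟙· w) ρ·u≡1) ⟩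
      ℤΣ.sum q ℤ.+ ℤ.- (ℤΣ.sum q ℤ.- c) ℤ.* 1ℤ     ≡⟨ cancel (ℤΣ.sum q) c ⟩
      c                                            ∎
      where
      cancel : ∀ σ c → σ ℤ.+ ℤ.- (σ ℤ.- c) ℤ.* 1ℤ ≡ c
      cancel = solve-∀

    y≡Lx : ∀ i → y i ≡ (L *ᵥ x) i
    y≡Lx i = begin
      y i
        ≡⟨ isolate (y i) c (t ℤ.* u i) ⟩
      embed y s t i ℤ.- c ℤ.* 1ℤ ℤ.- t ℤ.* u i
        ≡⟨ cong₂ (λ a b → a ℤ.- c ℤ.* 1ℤ ℤ.- b ℤ.* u i) (embed≡μq i)
             (trans t≡ (cong (τ ℤ.*_) (sym (ρμ≡Λ i)))) ⟩
      μ i ℤ.* q i ℤ.- c ℤ.* 1ℤ ℤ.- τ ℤ.* (ρ i ℤ.* μ i) ℤ.* u i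
        ≡⟨ collect (μ i) (q i) c τ (ρ i) (u i) ⟩
      μ i ℤ.* x i ℤ.+ ℤ.- c ℤ.* 1ℤ
        ≡⟨ cong (λ z → μ i ℤ.* x i ℤ.+ ℤ.- z ℤ.* 1ℤ) ∑x≡c ⟨
      μ i ℤ.* x i ℤ.+ ℤ.- ℤΣ.sum x ℤ.* 1ℤ
        ≡⟨ laplacian-*ᵥ x i ⟨
      (L *ᵥ x) i ∎
      where
      isolate : ∀ y c z → y ≡ y ℤ.+ c ℤ.* 1ℤ ℤ.+ z ℤ.- c ℤ.* 1ℤ ℤ.- z
      isolate = solve-∀
      collect : ∀ μ q c τ ρ u →
        μ ℤ.* q ℤ.- c ℤ.* 1ℤ ℤ.- τ ℤ.* (ρ ℤ.* μ) ℤ.* u ≡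
        μ ℤ.* (q ℤ.+ ℤ.- τ ℤ.* (ρ ℤ.* u)) ℤ.+ ℤ.- c ℤ.* 1ℤ
      collect = solve-∀

  -- Subtracting `(ρ · z) u` makes `z` orthogonal to `ρ`, and `t` restores it; `s` is chosen so that
  -- the coefficient of `𝟙` vanishes.
  embed-surjective : ∀ z → ∃ λ y → ∃ λ s → ∃ λ t → ρ · y ≡ 0ℤ × (∀ i → embed y s t i ≡ z i)
  embed-surjective z = y , w · y , ρ · z , ρ·y≡0 , λ i → cancel (z i) (ρ · z) (u i) (w · y)
    where
    y : Vector ℤ n
    y i = z i ℤ.+ ℤ.- ρ · z ℤ.* u i
    ρ·y≡0 : ρ · y ≡ 0ℤ
    ρ·y≡0 = begin
      ρ · y                              ≡⟨ ·-+* ρ z (ℤ.- ρ · z) u ⟩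
      ρ · z ℤ.+ ℤ.- ρ · z ℤ.* ρ · u      ≡⟨ cong (λ a → ρ · z ℤ.+ ℤ.- ρ · z ℤ.* a) ρ·u≡1 ⟩
      ρ · z ℤ.+ ℤ.- ρ · z ℤ.* 1ℤ         ≡⟨ cancel′ (ρ · z) ⟩
      0ℤ                                 ∎
      where
      cancel′ : ∀ a → a ℤ.+ ℤ.- a ℤ.* 1ℤ ≡ 0ℤ
      cancel′ = solve-∀
    cancel : ∀ z a u b → z ℤ.+ ℤ.- a ℤ.* u ℤ.+ (b ℤ.- b) ℤ.* 1ℤ ℤ.+ a ℤ.* u ≡ z
    cancel = solve-∀

  -- Assembling the isomorphism.

  criticalGroup-K-≅ : CriticalGroup (K n) S ⊕ (ℤ/ (lcms m) ⊕ ℤ/ (lcms m)) ≅ ⨁ (λ i → ℤ/ (m i))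
  criticalGroup-K-≅ = ≅-byKernel (CriticalGroup (K n) S ⊕ (ℤ/ (lcms m) ⊕ ℤ/ (lcms m))) H
    (λ ((y , _) , s , t) → embed y s t)
    (λ ((y , _) , s , t) ((y′ , _) , s′ , t′) → ≗⇒≈ (embed-+ y y′ s s′ t t′))
    (λ ((y , _) , s , t) ((x , y≡Lx) , Λ∣s , Λ∣t) i →
      z⇒z+0 (embed-vanishes {y} {x} {s} {t} (λ j → trans (sym (ℤ.+-identityʳ (y j))) (y≡Lx j))
               (z+0⇒z Λ∣s) (z+0⇒z Λ∣t) i))
    (λ ((y , tor) , s , t) μ∣ →
      let (x , y≡Lx) , Λ∣s , Λ∣t =
            embed-injective {y} {s} {t} (torsion⇒ρ·≡0 {y} tor) (λ i → z+0⇒z (μ∣ i))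
      in (x , λ j → trans (ℤ.+-identityʳ (y j)) (y≡Lx j)) , z⇒z+0 Λ∣s , z⇒z+0 Λ∣t)
    (λ z → let y , s , t , ρ·y≡0 , eq = embed-surjective z
           in ((y , ρ·≡0⇒torsion ρ·y≡0) , s , t) , ≗⇒≈ eq)
    where
    H : AbelianGroup _ _
    H = ⨁ (λ i → ℤ/ (m i))
    ≗⇒≈ : ∀ {x y} → (∀ i → x i ≡ y i) → AbelianGroup._≈_ H x y
    ≗⇒≈ {x} {y} x≗y i = divides 0ℤ (trans (cong (ℤ._- y i) (x≗y i)) (ℤ.+-inverseʳ (y i)))
    z+0⇒z : ∀ {k z} → k ∣ℤ z ℤ.+ 0ℤ → k ∣ℤ z
    z+0⇒z {k} {z} = subst (k ∣ℤ_) (ℤ.+-identityʳ z)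
    z⇒z+0 : ∀ {k z} → k ∣ℤ z → k ∣ℤ z ℤ.+ 0ℤ
    z⇒z+0 {k} {z} = subst (k ∣ℤ_) (sym (ℤ.+-identityʳ z))

corollary8 : ∀ (n : ℕ) (S : ArithmeticalStructure (K n)) →
    let open ArithmeticalStructure S using (d)
        ℓ = lcms (λ i → d i + 1)
    in CriticalGroup (K n) S ⊕ (ℤ/ ℓ ⊕ ℤ/ ℓ) ≅ ⨁ (λ i → ℤ/ (d i + 1))
corollary8 n S = criticalGroup-K-≅ S
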